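{- For every two trees $T_1, T_2$ (each with $\operatorname{diam}(T_i)>0$), we have $$\operatorname{capt}_2(T_1\square T_2) = \left\lfloor \frac{\operatorname{diam}(T_1\square T_2)}{2}\right\rfloor .$$
   Context: All graphs are undirected, simple, finite, and connected. $d(u,v)$ denotes the graph distance and $\operatorname{diam}(G)$ is the maximum distance between two vertices of $G$. The Cartesian product $G\square H$ has vertex set $V(G)\times V(H)$, with $(u_1,v_1)$ and $(u_2,v_2)$ adjacent iff either $u_1=u_2$ and $v_1v_2\in E(H)$, or $v_1=v_2$ and $u_1u_2\in E(G)$. Cops and Robber game with $k$ cops on $G$: players occupy vertices, and several players may occupy the same vertex. In round 0, first each of the $k$ cops chooses a starting vertex, then the robber chooses a starting vertex. In each subsequent round $1,2,\dots$, first each cop moves and then the robber moves; a move of a player consists of staying or going to an adjacent vertex. All positions are known to all players at all times. The game ends and the cops win (the robber is captured) as soon as the robber is at a vertex occupied by some cop. (Letting the robber move before the cops in each round after round 0 does not change the values below, and the paper adopts that convention.) The length of a game is $t$ if the robber is captured in round $t$, and infinite if she is never captured. The $k$-capture time $\operatorname{capt}_k(G)$ is the length of an optimal game: the least $t$ such that $k$ cops have a strategy (including the choice of starting vertices) guaranteeing capture in round at most $t$, whatever the robber does (infinite if there is no such $t$). -}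

module Defs where

open import Data.Fin using (Fin)
open import Data.Fin.Properties using (any?; *↔×) renaming (_≟_ to _≟ᶠ_)
open import Data.List using (List; []; _∷_; _++_; map; length; allFin; cartesianProductWith)
open import Data.List.Extrema.Nat using (max)
open import Data.List.Relation.Unary.Linked using (Linked)
open import Data.List.Relation.Unary.Unique.Propositional using (Unique)
open import Data.Nat using (ℕ; zero; suc; _+_; _*_; _≤_; z≤n; s≤s)
open import Data.Product using (Σ; ∃; ∃-syntax; _×_; _,_; proj₁; proj₂)
open import Data.Product.Function.NonDependent.Propositional using (_×-↔_)
open import Data.Sum using (_⊎_; inj₁; inj₂)
open import Function using (_∘_)
open import Function.Bundles using (_↔_; module Inverse)
open import Function.Construct.Composition using (_↔-∘_)
open import Relation.Binary.Core using (Rel)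
open import Relation.Binary.Definitions using (Decidable; DecidableEquality; Symmetric)
open import Relation.Binary.PropositionalEquality using (_≡_; refl; sym; trans; cong; subst)
open import Relation.Nullary using (¬_; Dec; yes; no; contradiction)
open import Relation.Nullary.Decidable using (map′; _×-dec_; _⊎-dec_)
import Relation.Unary as Unary

module _ {V : Set} (_~_ : V → V → Set) where

  -- The index is the number of edges.
  data Walk : V → V → ℕ → Set where
    stop : ∀ {u} → Walk u u 0
    step : ∀ {u v w n} → u ~ v → Walk v w n → Walk u w (suc n)

module _ {V : Set} {_~_ : V → V → Set} where

  infixr 5 _⟫_
  _⟫_ : ∀ {u v w m n} → Walk _~_ u v m → Walk _~_ v w n → Walk _~_ u w (m + n)
  stop     ⟫ q = q
  step e p ⟫ q = step e (p ⟫ q)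

mapWalk : ∀ {V W : Set} {_~_ : V → V → Set} {_≈_ : W → W → Set} (f : V → W) →
          (∀ {u v} → u ~ v → f u ≈ f v) →
          ∀ {u v n} → Walk _~_ u v n → Walk _≈_ (f u) (f v) n
mapWalk f h stop       = stop
mapWalk f h (step e p) = step (h e) (mapWalk f h p)

-- Finite simple connected graphs.  Adjacency in a finite graph is given by
-- finite data, hence it is required to be decidable.

record Graph : Set₁ where
  infix 4 _~_ _~?_
  field
    Vertex    : Set
    order     : ℕ
    enum      : Fin order ↔ Vertex
    _~_       : Rel Vertex _
    _~?_      : Decidable _~_
    ~-sym     : Symmetric _~_
    ~-irrefl  : ∀ {v} → ¬ v ~ v
    connected : ∀ u v → ∃ λ n → Walk _~_ u v n

  open Inverse enum public using (to; from)

  to∘from : ∀ v → to (from v) ≡ v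
  to∘from v = Inverse.inverseˡ enum refl

  infix 4 _≟_
  _≟_ : DecidableEquality Vertex
  u ≟ v = map′ (λ e → trans (sym (to∘from u)) (trans (cong to e) (to∘from v)))
               (cong from) (from u ≟ᶠ from v)

  anyVertex? : {P : Vertex → Set} → Unary.Decidable P → Dec (∃ P)
  anyVertex? {P} P? = map′ (λ (i , p) → to i , p)
                           (λ (v , p) → from v , subst P (sym (to∘from v)) p)
                           (any? (P? ∘ to))

  walk? : ∀ n u v → Dec (Walk _~_ u v n)
  walk? zero    u v = map′ (λ { refl → stop }) (λ { stop → refl }) (u ≟ v)
  walk? (suc n) u v = map′ (λ (_ , e , p) → step e p) (λ { (step e p) → _ , e , p })
                           (anyVertex? λ w → (u ~? w) ×-dec walk? n w v)

  vertices : List Vertex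
  vertices = map to (allFin order)

least : {P : ℕ → Set} → Unary.Decidable P → ∀ n → P n →
        ∃[ d ] P d × (∀ m → P m → d ≤ m)
least P? n p with P? 0
... | yes p₀ = 0 , p₀ , λ _ _ → z≤n
least P? zero    p | no ¬p₀ = contradiction p ¬p₀
least P? (suc n) p | no ¬p₀ with least (P? ∘ suc) n p
... | d , pd , min = suc d , pd , λ { zero p₀ → contradiction p₀ ¬p₀
                                    ; (suc m) pm → s≤s (min m pm) }

module _ (G : Graph) where
  open Graph G

  shortestWalk : ∀ u v → ∃[ d ] Walk _~_ u v d × (∀ m → Walk _~_ u v m → d ≤ m)
  shortestWalk u v = let (n , p) = connected u v in least (λ m → walk? m u v) n p

  dist : Vertex → Vertex → ℕ
  dist u v = proj₁ (shortestWalk u v)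

  diam : ℕ
  diam = max 0 (cartesianProductWith dist vertices vertices)

module _ (G : Graph) where
  open Graph G

  -- v ∷ vs lists the distinct vertices of a cycle, at least three, in order.
  IsCycle : Vertex → List Vertex → Set
  IsCycle v vs = 2 ≤ length vs × Unique (v ∷ vs) × Linked _~_ (v ∷ vs ++ v ∷ [])

  -- Connectedness is part of Graph.
  IsTree : Set
  IsTree = ∀ v vs → ¬ IsCycle v vs

module _ (G H : Graph) where
  private
    module G = Graph G
    module H = Graph H

  data □-Adj : G.Vertex × H.Vertex → G.Vertex × H.Vertex → Set where
    moveʳ : ∀ {u₁ u₂ v₁ v₂} → u₁ ≡ u₂ → v₁ H.~ v₂ → □-Adj (u₁ , v₁) (u₂ , v₂)
    moveˡ : ∀ {u₁ u₂ v₁ v₂} → v₁ ≡ v₂ → u₁ G.~ u₂ → □-Adj (u₁ , v₁) (u₂ , v₂)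

infixr 6 _□_
_□_ : Graph → Graph → Graph
G □ H = record
  { Vertex    = G.Vertex × H.Vertex
  ; order     = G.order * H.order
  ; enum      = (G.enum ×-↔ H.enum) ↔-∘ *↔×
  ; _~_       = □-Adj G H
  ; _~?_      = λ (u₁ , v₁) (u₂ , v₂) →
      map′ (λ { (inj₁ (e , a)) → moveʳ e a ; (inj₂ (e , a)) → moveˡ e a })
           (λ { (moveʳ e a) → inj₁ (e , a) ; (moveˡ e a) → inj₂ (e , a) })
           (((u₁ G.≟ u₂) ×-dec (v₁ H.~? v₂)) ⊎-dec ((v₁ H.≟ v₂) ×-dec (u₁ G.~? u₂)))
  ; ~-sym     = λ { (moveʳ e a) → moveʳ (sym e) (H.~-sym a)
                  ; (moveˡ e a) → moveˡ (sym e) (G.~-sym a) }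
  ; ~-irrefl  = λ { (moveʳ _ a) → H.~-irrefl a ; (moveˡ _ a) → G.~-irrefl a }
  ; connected = λ (u₁ , v₁) (u₂ , v₂) →
      let (m , p) = G.connected u₁ u₂
          (n , q) = H.connected v₁ v₂
      in m + n , mapWalk (_, v₁) (moveˡ refl) p ⟫ mapWalk (u₂ ,_) (moveʳ refl) q
  }
  where
  module G = Graph G
  module H = Graph H

module Game (k : ℕ) (G : Graph) where
  open Graph G

  -- A legal move of one player: stay or go to an adjacent vertex.
  Move : Vertex → Vertex → Set
  Move u v = u ≡ v ⊎ u ~ v

  -- The robber's positions so far, most recent first.
  History : Set
  History = List Vertex

  -- A deterministic strategy of the k cops, who see everything.  Their own past
  -- positions are determined by the strategy, so a strategy assigns to each
  -- robber history the cops' positions chosen in reply to it; cops [] are the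
  -- starting vertices, chosen before the robber's.
  record Strategy : Set where
    field
      cops  : History → Fin k → Vertex
      legal : ∀ h r j → Move (cops h j) (cops (r ∷ h) j)

  -- A complete behaviour of the robber: her vertex at the end of each round.
  -- Ranging over all of these covers every way she can play against a given
  -- strategy; what happens after a capture is irrelevant.
  record RobberPlay : Set where
    field
      robber : ℕ → Vertex
      legal  : ∀ i → Move (robber i) (robber (suc i))

    -- What the cops have seen when they move in round i.
    before : ℕ → History
    before zero    = []
    before (suc i) = robber i ∷ before i

  module _ (σ : Strategy) (ρ : RobberPlay) where
    open Strategy σ using (cops)
    open RobberPlay ρ using (robber; before)

    -- In round i some cop stands on vertex v.
    Occupied : ℕ → Vertex → Set
    Occupied i v = ∃ λ j → cops (before i) j ≡ v

    -- In a round after round 0 a cop may move onto the robber, who is still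
    -- where she was at the end of the previous round, or she may move onto a cop.
    CapturedIn : ℕ → Set
    CapturedIn zero    = Occupied 0 (robber 0)
    CapturedIn (suc i) = Occupied (suc i) (robber i) ⊎ Occupied (suc i) (robber (suc i))

  CopsWinWithin : ℕ → Set
  CopsWinWithin t = Σ Strategy λ σ → ∀ ρ → ∃[ i ] i ≤ t × CapturedIn σ ρ i

-- capt_k(G) = t for a natural number t; capt_k(G) is infinite when no t qualifies.
IsCaptureTime : ℕ → Graph → ℕ → Set
IsCaptureTime k G t = CopsWinWithin t × (∀ s → CopsWinWithin s → t ≤ s)
  where open Game k G

-- Upper bound.  T₁ has a central edge c c′, with every vertex within ⌊diam T₁/2⌋
-- of c or c′, and T₂ a center e of eccentricity ⌈diam T₂/2⌉.  The cops start at
-- (c , e) and (c′ , e), and each always approaches the robber in the tree where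
-- he is farther from her.  Each then stays between his start and the robber in
-- both trees and comes one step closer per round.  She can only get past a cop
-- at distance 1 from her, and then the other cop, who was at distance 2,
-- captures her in the next round.  If ⌊diam T₁/2⌋ + ⌈diam T₂/2⌉ is too large,
-- the trees are swapped.
--
-- Lower bound.  To survive round s, where 2 (s + 1) ≤ diam T₁ + diam T₂, the
-- robber considers two corners that are diametral in both trees.  If neither
-- cop is within s of one of them, she stays there.  Otherwise each cop is far
-- from a corner the other cop is close to; she moves on a unit square at one of
-- the corners, diagonally opposite to the close cop, who never captures her
-- there, and the far cop arrives too late.

module Submission where

open import Defs
open import Data.Fin using (Fin; zero; suc; opposite)
open import Data.Fin.Properties using (opposite-involutive)
open import Data.List using (List; []; _∷_; _++_; length; map; cartesianProductWith)
import Data.List.Extrema.Nat as Extrema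
open import Data.List.Membership.Propositional using (_∈_)
open import Data.List.Membership.Propositional.Properties
  using (∈-map⁺; ∈-allFin; ∈-cartesianProductWith⁺; ∈-cartesianProductWith⁻)
open import Data.List.Relation.Unary.All as All using (All; []; _∷_)
import Data.List.Relation.Unary.All.Properties as Allₚ
open import Data.List.Relation.Unary.AllPairs using ([]; _∷_)
import Data.List.Relation.Unary.AllPairs.Properties as AllPairsₚ
open import Data.List.Relation.Unary.Linked using (Linked; [-]; _∷_)
open import Data.List.Relation.Unary.Unique.Propositional using (Unique)
open import Data.Nat using (ℕ; zero; suc; _+_; _≤_; _<_; _≤?_; _<?_; z≤n; s≤s; s≤s⁻¹; ⌊_/2⌋; ⌈_/2⌉)
open import Data.Nat.Properties hiding (_≟_; _≤?_; _<?_)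
open import Data.Nat.Tactic.RingSolver using (solve-∀)
open import Data.Product using (∃; ∃-syntax; _×_; _,_; proj₁; proj₂; swap)
open import Data.Sum as Sum using (_⊎_; inj₁; inj₂; [_,_]′)
open import Algebra.Properties.CommutativeSemigroup +-commutativeSemigroup using (interchange)
open import Function using (_∘_; id)
open import Relation.Binary.Definitions using (tri<; tri≈; tri>)
open import Relation.Binary.PropositionalEquality
  using (_≡_; _≢_; refl; sym; trans; cong; cong₂; subst; ≢-sym; module ≡-Reasoning)
open import Relation.Nullary using (¬_; yes; no; contradiction)

-- Distances in graphs, trees and products

module Distance (G : Graph) where
  open Graph G

  private variable
    u v w x y : Vertex
    m n : ℕ

  -- Abstract, so that type checking never unfolds the search behind `dist`.
  abstract
    d : Vertex → Vertex → ℕ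
    d = dist G

    d≡dist : ∀ u v → d u v ≡ dist G u v
    d≡dist u v = refl

    d-walk : ∀ u v → Walk _~_ u v (d u v)
    d-walk u v = proj₁ (proj₂ (shortestWalk G u v))

    d-minimal : Walk _~_ u v n → d u v ≤ n
    d-minimal {u} {v} = proj₂ (proj₂ (shortestWalk G u v)) _

  walk-snoc : Walk _~_ u v n → v ~ w → Walk _~_ u w (suc n)
  walk-snoc stop       a = step a stop
  walk-snoc (step e p) a = step e (walk-snoc p a)

  walk-reverse : Walk _~_ u v n → Walk _~_ v u n
  walk-reverse stop       = stop
  walk-reverse (step e p) = walk-snoc (walk-reverse p) (~-sym e)

  d-self : ∀ u → d u u ≡ 0
  d-self u = n≤0⇒n≡0 (d-minimal stop)

  d≡0⇒≡ : d u v ≡ 0 → u ≡ v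
  d≡0⇒≡ {u} {v} e with subst (Walk _~_ u v) e (d-walk u v)
  ... | stop = refl

  d-sym : ∀ u v → d u v ≡ d v u
  d-sym u v = ≤-antisym (d-minimal (walk-reverse (d-walk v u)))
                        (d-minimal (walk-reverse (d-walk u v)))

  d-triangle : ∀ u v w → d u w ≤ d u v + d v w
  d-triangle u v w = d-minimal (d-walk u v ⟫ d-walk v w)

  d-adjˡ : u ~ v → d u w ≤ suc (d v w)
  d-adjˡ e = d-minimal (step e (d-walk _ _))

  d-adjʳ : v ~ w → d u w ≤ suc (d u v)
  d-adjʳ e = d-minimal (walk-snoc (d-walk _ _) e)

  closer : d u v ≡ suc n → ∃[ w ] u ~ w × d w v ≡ n
  closer {u} {v} e with subst (Walk _~_ u v) e (d-walk u v)
  ... | step a p = _ , a , ≤-antisym (d-minimal p)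
                                     (s≤s⁻¹ (≤-trans (≤-reflexive (sym e)) (d-adjˡ a)))

  toward : ∀ u v → u ≡ v ⊎ (∃[ w ] u ~ w × d u v ≡ suc (d w v))
  toward u v with d u v in e
  ... | zero  = inj₁ (d≡0⇒≡ e)
  ... | suc n = let (w , a , q) = closer e in inj₂ (w , a , cong suc (sym q))

  d-split : d u v ≡ m + n → ∃[ w ] d u w ≡ m × d w v ≡ n
  d-split {u} {m = zero}  e = u , d-self u , e
  d-split {u} {v} {m = suc m} {n} e with closer e
  ... | x , a , q with d-split {x} {v} {m} q
  ... | w , xw , wv = w , ≤-antisym (≤-trans (d-adjˡ a) (s≤s (≤-reflexive xw))) below , wv
    where
    below : suc m ≤ d u w
    below = +-cancelʳ-≤ n (suc m) (d u w)
              (subst (λ k → suc m + n ≤ d u w + k) wv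
                     (≤-trans (≤-reflexive (sym e)) (d-triangle u w v)))

  d≤diam : ∀ u v → d u v ≤ diam G
  d≤diam u v = ≤-trans (≤-reflexive (d≡dist u v))
    (All.lookup (Extrema.xs≤max 0 _) (∈-cartesianProductWith⁺ (dist G) (∈-vertices u) (∈-vertices v)))
    where
    ∈-vertices : ∀ w → w ∈ vertices
    ∈-vertices w = subst (_∈ vertices) (to∘from w) (∈-map⁺ to (∈-allFin (from w)))

  diam-attained : 0 < diam G → ∃[ u ] ∃[ v ] d u v ≡ diam G
  diam-attained 0<diam with Extrema.argmax-sel id 0 (cartesianProductWith (dist G) vertices vertices)
  ... | inj₁ e = contradiction e (≢-sym (<⇒≢ 0<diam))
  ... | inj₂ i = let (u , v , _ , _ , e) = ∈-cartesianProductWith⁻ (dist G) vertices vertices i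
                 in u , v , trans (d≡dist u v) (sym e)

  -- That is, `u` lies on a shortest walk from `z` to `x`; in a tree, on the path joining them.
  Between : Vertex → Vertex → Vertex → Set
  Between z u x = d z x ≡ d z u + d u x

  between-start : ∀ z x → Between z z x
  between-start z x = cong (_+ d z x) (sym (d-self z))

  between-toward : ∀ {z} → Between z u x → u ~ w → d u x ≡ suc (d w x) →
                   Between z w x × d z w ≡ suc (d z u)
  between-toward {u} {x} {w} {z} b e c = trans path (cong (_+ d w x) (sym zw)) , zw
    where
    path : d z x ≡ suc (d z u) + d w x
    path = trans b (trans (cong (d z u +_) c) (+-suc (d z u) (d w x)))
    zw : d z w ≡ suc (d z u)
    zw = ≤-antisym (d-adjʳ e)
           (+-cancelʳ-≤ (d w x) (suc (d z u)) (d z w)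
             (≤-trans (≤-reflexive (sym path)) (d-triangle z w x)))

module Tree (G : Graph) (acyclic : IsTree G) where
  open Graph G
  open Distance G public

  private variable
    u x y x′ y′ : Vertex

  private
    linked-snoc : ∀ u ps → Linked _~_ (u ∷ ps ++ x ∷ []) → x ~ y →
                  Linked _~_ (u ∷ (ps ++ x ∷ []) ++ y ∷ [])
    linked-snoc u []       (a ∷ [-]) e = a ∷ e ∷ [-]
    linked-snoc u (p ∷ ps) (a ∷ l)   e = a ∷ linked-snoc p ps l e

    all-fresh : ∀ {z n} → n < d z y → ∀ {ps} → All (λ w → d z w ≤ n) ps → All (y ≢_) ps
    all-fresh {y} {z} n<y = All.map λ {w} w≤n y≡w → <⇒≱ n<y (subst (λ v → d z v ≤ _) (sym y≡w) w≤n)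

  -- A path from y to y′ through vertices closer to z: two shortest walks
  -- towards z, up to the point where they meet.
  Arc : Vertex → ℕ → Vertex → Vertex → List Vertex → Set
  Arc z n y y′ ps = 1 ≤ length ps × All (λ w → d z w ≤ n) (y ∷ ps ++ y′ ∷ []) ×
                    Linked _~_ (y ∷ ps ++ y′ ∷ []) × Unique (y ∷ ps ++ y′ ∷ [])

  -- Induction on the level `n`: both ends step to neighbours nearer to `z`, which either coincide
  -- or are joined by an arc one level lower. The ends are new to that arc because they lie higher.
  arc : ∀ z n → y ≢ y′ → d z y ≡ n → d z y′ ≡ n → ∃ (Arc z n y y′)
  arc z zero y≢y′ e e′ = contradiction (trans (sym (d≡0⇒≡ e)) (d≡0⇒≡ e′)) y≢y′
  arc {y} {y′} z (suc n) y≢y′ e e′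
    with closer (trans (d-sym y z) e) | closer (trans (d-sym y′ z) e′)
  ... | w , a , q | w′ , a′ , q′ = join (w ≟ w′)
    where
    zw  = trans (d-sym z w) q
    zw′ = trans (d-sym z w′) q′
    fresh : ∀ {v} → d z v ≡ suc n → ∀ {ps} → All (λ u → d z u ≤ n) ps → All (v ≢_) ps
    fresh e = all-fresh (≤-reflexive (sym e))
    join : _ → ∃ (Arc z (suc n) y y′)
    join (yes refl) = w ∷ [] , s≤s z≤n ,
      ≤-reflexive e ∷ m≤n⇒m≤1+n (≤-reflexive zw) ∷ ≤-reflexive e′ ∷ [] ,
      a ∷ ~-sym a′ ∷ [-] ,
      (y≢w ∷ y≢y′ ∷ []) ∷ (≢-sym y′≢w ∷ []) ∷ [] ∷ []
      where
      y≢w : y ≢ w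
      y≢w refl = 1+n≢n (trans (sym e) zw)
      y′≢w : y′ ≢ w
      y′≢w refl = 1+n≢n (trans (sym e′) zw)
    join (no w≢w′) with arc z n w≢w′ zw zw′
    ... | ps , _ , low , link , uniq = w ∷ ps ++ w′ ∷ [] , s≤s z≤n ,
      ≤-reflexive e ∷ Allₚ.++⁺ (All.map m≤n⇒m≤1+n low) (≤-reflexive e′ ∷ []) ,
      a ∷ linked-snoc w ps link (~-sym a′) ,
      Allₚ.++⁺ (fresh e low) (y≢y′ ∷ []) ∷
      AllPairsₚ.++⁺ uniq ([] ∷ [])
        (All.map (λ ne → ≢-sym ne ∷ []) (fresh e′ low))

  -- An edge within one level would close an arc to a cycle.
  d-adj-≢ : ∀ z → x ~ y → d z x ≢ d z y
  d-adj-≢ {x} {y} z a e with arc z (d z x) (λ { refl → ~-irrefl a }) refl (sym e)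
  ... | p ∷ ps , _ , _ , link , uniq =
    acyclic x (p ∷ ps ++ y ∷ [])
      (s≤s (≤-trans (s≤s z≤n) (≤-reflexive (sym (length-snoc ps)))) , uniq , linked-snoc x (p ∷ ps) link (~-sym a))
    where
    length-snoc : ∀ ps → length (ps ++ y ∷ []) ≡ suc (length ps)
    length-snoc []       = refl
    length-snoc (_ ∷ ps) = cong suc (length-snoc ps)

  -- Two distinct parents would be joined by an arc that stays below the level of `x`, and `x` would
  -- close it to a cycle.
  parent-unique : ∀ z → x ~ y → x ~ y′ →
                  d z x ≡ suc (d z y) → d z x ≡ suc (d z y′) → y ≡ y′
  parent-unique {x} {y} {y′} z a a′ e e′ with y ≟ y′
  ... | yes y≡y′ = y≡y′
  ... | no  y≢y′ with arc z (d z y) y≢y′ refl (suc-injective (trans (sym e′) e))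
  ... | p ∷ ps , _ , low , link , uniq =
    contradiction (s≤s (s≤s z≤n) , all-fresh (≤-reflexive (sym e)) low ∷ uniq ,
                   a ∷ linked-snoc y (p ∷ ps) link (~-sym a′))
                  (acyclic x (y ∷ p ∷ ps ++ y′ ∷ []))

  d-adj : ∀ z → x ~ y → d z y ≡ suc (d z x) ⊎ d z x ≡ suc (d z y)
  d-adj {x} {y} z a with <-cmp (d z x) (d z y)
  ... | tri< lt _ _ = inj₁ (≤-antisym (d-adjʳ a) lt)
  ... | tri≈ _ eq _ = contradiction eq (d-adj-≢ z a)
  ... | tri> _ _ gt = inj₂ (≤-antisym (d-adjʳ (~-sym a)) gt)

  -- A move away from `z` prolongs the path from `z`. A move back leads to the unique parent of `x`,
  -- and `u` is still on the path to it unless `u` is `x` itself.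
  follow : ∀ {z} → Between z u x → x ~ x′ →
           Between z u x′ ⊎ (u ≡ x × u ≢ z × d z x ≡ suc (d z x′))
  follow {u} {x} {x′} {z} b a with d-adj z a
  ... | inj₁ up = inj₁ (≤-antisym (d-triangle z u x′)
        (≤-trans (+-monoʳ-≤ (d z u) (d-adjʳ a))
          (≤-reflexive (trans (+-suc (d z u) (d u x)) (trans (cong suc (sym b)) (sym up))))))
  ... | inj₂ down with toward x u
  ... | inj₁ refl with u ≟ z
  ...   | yes refl = inj₁ (between-start u x′)
  ...   | no u≢z   = inj₂ (refl , u≢z , down)
  follow {u} {x} {x′} {z} b a | inj₂ down | inj₂ (y , x~y , xu) with
    parent-unique z x~y a (≤-antisym (d-adjʳ (~-sym x~y)) zy<zx) down
    where
    zx : d z x ≡ suc (d z u + d u y)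
    zx = trans b (trans (cong (d z u +_) (trans (d-sym u x) (trans xu (cong suc (d-sym y u)))))
                        (+-suc (d z u) (d u y)))
    zy<zx : suc (d z y) ≤ d z x
    zy<zx = ≤-trans (s≤s (d-triangle z u y)) (≤-reflexive (sym zx))
  ... | refl = inj₁ (suc-injective (trans (sym down) (trans b
        (trans (cong (d z u +_) (trans (d-sym u x) (trans xu (cong suc (d-sym y u)))))
               (+-suc (d z u) (d u y))))))

  -- The part of the tree behind `u`, as seen from `z`, can only be left through `u`.
  leave-through : ∀ {z n} → Walk _~_ x y n → Between z u x → ¬ Between z u y →
                  d x u + d u y ≤ n
  leave-through stop b ¬b = contradiction b ¬b
  leave-through {x} {y} {u = u} (step {n = n} a p) b ¬b with follow b a
  ... | inj₁ b′ = ≤-trans (+-monoˡ-≤ (d u y) (d-adjˡ a)) (s≤s (leave-through p b′ ¬b))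
  ... | inj₂ (refl , _) = subst (λ k → k + d u y ≤ suc n) (sym (d-self u)) (d-minimal (step a p))

  -- `c` and `c′` are consecutive in the middle of a diametral path from `x` to `y`. Their edge
  -- splits the tree in two, and a vertex too far from the end on its own side would be more than
  -- `a` away from `y` or `x` on the other side.
  center-edge : ∀ {a} → (∀ u v → d u v ≤ a) → 0 < a → d x y ≡ a →
    ∃[ c ] ∃[ c′ ] c ~ c′ × (∀ w → d c w ≤ ⌈ a /2⌉) ×
      (∀ w → d c w ≤ ⌊ a /2⌋ ⊎ d c′ w ≤ ⌊ a /2⌋)
  center-edge {x} {y} {suc n} bounded _ xy
    with d-split (trans xy (sym (⌊n/2⌋+⌈n/2⌉≡n (suc n))))
  ... | c , xc , cy with closer cy
  ... | c′ , c~c′ , c′y = c , c′ , c~c′ , ecc , near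
    where
    f = ⌊ suc n /2⌋
    k = ⌊ n /2⌋

    -- With `a` = `suc n`, the lower half of `a` is `f` and the upper half is `suc k`.
    a≡ : suc n ≡ k + suc f
    a≡ = trans (sym (⌊n/2⌋+⌈n/2⌉≡n (suc n))) (trans (+-suc f k) (trans (cong suc (+-comm f k)) (sym (+-suc k f))))

    cc′ : d c c′ ≡ 1
    cc′ = ≤-antisym (subst (λ k → d c c′ ≤ suc k) (d-self c′) (d-adjˡ c~c′))
                    (n≢0⇒n>0 λ e → ~-irrefl (subst (c ~_) (sym (d≡0⇒≡ e)) c~c′))

    beyond : ∀ {w} → d c w ≡ suc (d c′ w) → Between c c′ w
    beyond {w} e = trans e (cong (_+ d c′ w) (sym cc′))

    not-beyond : ∀ {w} → d c w ≤ d c′ w → ¬ Between c c′ w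
    not-beyond le b = <⇒≱ (≤-reflexive (sym (trans b (cong (_+ _) cc′)))) le

    c′x : suc f ≤ d c′ x
    c′x = +-cancelˡ-≤ k (suc f) (d c′ x) (≤-trans (≤-reflexive (trans (sym a≡) (sym xy)))
            (≤-trans (d-triangle x c′ y)
              (≤-reflexive (trans (+-comm (d x c′) (d c′ y)) (cong₂ _+_ c′y (d-sym x c′))))))

    side : ∀ w → (d c′ w ≡ suc (d c w) × d c w ≤ f) ⊎ (d c w ≡ suc (d c′ w) × d c′ w ≤ k)
    side w with d-adj w c~c′
    ... | inj₁ e = inj₁ (e′ , s≤s⁻¹ (+-cancelˡ-≤ k (suc (d c w)) (suc f)
            (≤-trans (≤-reflexive (cong₂ _+_ (sym (trans (d-sym y c′) c′y)) (sym e′)))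
              (≤-trans (leave-through (d-walk y w) (beyond (trans cy (cong suc (sym c′y))))
                                      (not-beyond (≤-trans (n≤1+n _) (≤-reflexive (sym e′)))))
                (≤-trans (bounded y w) (≤-reflexive a≡))))))
      where
      e′ : d c′ w ≡ suc (d c w)
      e′ = trans (d-sym c′ w) (trans e (cong suc (d-sym w c)))
    ... | inj₂ e = inj₂ (e′ , +-cancelʳ-≤ (suc f) (d c′ w) k
            (≤-trans (+-monoʳ-≤ (d c′ w) c′x)
              (≤-trans (subst (λ k → k + d c′ x ≤ d w x) (d-sym w c′)
                 (leave-through (d-walk w x) (beyond e′)
                   (not-beyond (≤-trans (≤-reflexive (trans (d-sym c x) xc)) (≤-trans (n≤1+n f) c′x)))))
                (≤-trans (bounded w x) (≤-reflexive a≡)))))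
      where
      e′ : d c w ≡ suc (d c′ w)
      e′ = trans (d-sym c w) (trans e (cong suc (d-sym w c′)))

    ecc : ∀ w → d c w ≤ suc k
    ecc w with side w
    ... | inj₁ (_ , cw≤f) = ≤-trans cw≤f (⌊n/2⌋≤⌈n/2⌉ (suc n))
    ... | inj₂ (e , c′w≤k) = ≤-trans (≤-reflexive e) (s≤s c′w≤k)

    near : ∀ w → d c w ≤ f ⊎ d c′ w ≤ f
    near w with side w
    ... | inj₁ (_ , cw≤f) = inj₁ cw≤f
    ... | inj₂ (_ , c′w≤k) = inj₂ (≤-trans c′w≤k (⌊n/2⌋-mono (n≤1+n n)))

  -- No neighbour of `x` is farther from `y`, so each is the unique parent of `x` with respect to
  -- `y`.
  diametral-leaf : (∀ u v → d u v ≤ d y x) → 0 < d y x →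
    ∃[ x′ ] x ~ x′ × (∀ {w} → x ~ w → w ≡ x′)
  diametral-leaf {y} {x} maximal 0<yx with toward x y
  ... | inj₁ refl = contradiction (sym (d-self x)) (<⇒≢ 0<yx)
  ... | inj₂ (x′ , a , _) = x′ , a , λ b → parent-unique y b a (up b) (up a)
    where
    up : ∀ {w} → x ~ w → d y x ≡ suc (d y w)
    up {w} b with d-adj y b
    ... | inj₁ e = contradiction (≤-trans (≤-reflexive (sym e)) (maximal y w)) (<-irrefl refl)
    ... | inj₂ e = e

module Product (G H : Graph) where
  private
    module G = Distance G
    module H = Distance H
    module G□H = Distance (G □ H)
  open Graph (G □ H) using (Vertex; _~_)

  δ : Vertex → Vertex → ℕ
  δ (u , v) (x , y) = G.d u x + H.d v y

  δ≡0⇒≡ : ∀ {p q} → δ p q ≡ 0 → p ≡ q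
  δ≡0⇒≡ {u , v} {x , y} e =
    cong₂ _,_ (G.d≡0⇒≡ (m+n≡0⇒m≡0 (G.d u x) e)) (H.d≡0⇒≡ (m+n≡0⇒n≡0 (G.d u x) e))

  δ-self : ∀ p → δ p p ≡ 0
  δ-self (u , v) = cong₂ _+_ (G.d-self u) (H.d-self v)

  δ-adj : ∀ {p q} r → p ~ q → δ p r ≤ suc (δ q r)
  δ-adj {u , v} (x , y) (moveʳ {v₂ = v′} refl a) =
    ≤-trans (+-monoʳ-≤ (G.d u x) (H.d-adjˡ a)) (≤-reflexive (+-suc (G.d u x) (H.d v′ y)))
  δ-adj (x , y) (moveˡ refl a) = +-monoˡ-≤ _ (G.d-adjˡ a)

  δ-minimal : ∀ {p q n} → Walk _~_ p q n → δ p q ≤ n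
  δ-minimal {p} stop       = ≤-reflexive (δ-self p)
  δ-minimal     (step a w) = ≤-trans (δ-adj _ a) (s≤s (δ-minimal w))

  d≡δ : ∀ p q → G□H.d p q ≡ δ p q
  d≡δ p@(u , v) q@(x , y) = ≤-antisym
    (G□H.d-minimal (mapWalk (_, v) (moveˡ refl) (G.d-walk u x) ⟫ mapWalk (x ,_) (moveʳ refl) (H.d-walk v y)))
    (δ-minimal (G□H.d-walk p q))

  diam-□ : 0 < diam G → 0 < diam H → diam (G □ H) ≡ diam G + diam H
  diam-□ 0<a 0<b = ≤-antisym upper lower
    where
    lower : diam G + diam H ≤ diam (G □ H)
    lower = let (x , x′ , e) = G.diam-attained 0<a
                (y , y′ , f) = H.diam-attained 0<b
            in ≤-trans (≤-reflexive (sym (trans (d≡δ (x , y) (x′ , y′)) (cong₂ _+_ e f)))) (G□H.d≤diam _ _)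
    upper : diam (G □ H) ≤ diam G + diam H
    -- `diam-attained` needs a positive diameter of the product, which `lower` supplies.
    upper = let (p@(u , v) , q@(x , y) , e) = G□H.diam-attained (≤-trans 0<a (≤-trans (m≤m+n _ _) lower))
            in ≤-trans (≤-reflexive (trans (sym e) (d≡δ p q))) (+-mono-≤ (G.d≤diam u x) (H.d≤diam v y))

-- The cops' strategy

both : ∀ {P : Fin 2 → Set} i → P i → P (opposite i) → ∀ j → P j
both zero       p q zero       = p
both zero       p q (suc zero) = q
both (suc zero) p q zero       = q
both (suc zero) p q (suc zero) = p

module Pursuit (T₁ T₂ : Graph) (acyclic₁ : IsTree T₁) (acyclic₂ : IsTree T₂) where
  private
    module L = Tree T₁ acyclic₁
    module R = Tree T₂ acyclic₂
    module |L| = Graph T₁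
    module |R| = Graph T₂
  open Graph (T₁ □ T₂) using (Vertex)
  open Game 2 (T₁ □ T₂)
  open Product T₁ T₂ using (δ; δ-self; δ≡0⇒≡)

  -- A relation, so that proofs can match on the kind of move. On a tie it admits both trees.
  data Chase : Vertex → Vertex → Vertex → Set where
    here  : ∀ {p} → Chase p p p
    left  : ∀ {u v x y w} → R.d v y ≤ L.d u x → u |L|.~ w → L.d u x ≡ suc (L.d w x) →
            Chase (u , v) (x , y) (w , v)
    right : ∀ {u v x y w} → L.d u x ≤ R.d v y → v |R|.~ w → R.d v y ≡ suc (R.d w y) →
            Chase (u , v) (x , y) (u , w)

  abstract
    chase : ∀ p r → ∃ (Chase p r)
    chase (u , v) (x , y) with R.d v y ≤? L.d u x
    chase (u , v) (x , y) | yes le with L.toward u x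
    ... | inj₁ refl with R.d≡0⇒≡ (n≤0⇒n≡0 (≤-trans le (≤-reflexive (L.d-self u))))
    ...   | refl = _ , here
    chase (u , v) (x , y) | yes le | inj₂ (w , a , e) = _ , left le a e
    chase (u , v) (x , y) | no nle with R.toward v y
    ... | inj₁ refl = contradiction (≤-trans (≤-reflexive (R.d-self v)) z≤n) nle
    ... | inj₂ (w , a , e) = _ , right (<⇒≤ (≰⇒> nle)) a e

  chase-legal : ∀ {p r q} → Chase p r q → Move p q
  chase-legal here          = inj₁ refl
  chase-legal (left _ a _)  = inj₂ (moveˡ refl a)
  chase-legal (right _ a _) = inj₂ (moveʳ refl a)

  chase-closer : ∀ {p r q} → Chase p r q → 0 < δ p r → δ p r ≡ suc (δ q r)
  chase-closer here 0<δ = contradiction (sym (δ-self _)) (<⇒≢ 0<δ)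
  chase-closer (left _ _ e) _ = cong (_+ _) e
  chase-closer (right {u} {v} {x} {y} {w} _ _ e) _ = trans (cong (L.d u x +_) e) (+-suc (L.d u x) (R.d w y))

  -- A cop that started at s and has moved t times stands at p between s and the
  -- robber r in both trees, and its distances to the robber in the two trees
  -- differ by at most k, unless it never moved in the tree where it is closer.
  record Tracks (k t : ℕ) (s p r : Vertex) : Set where
    constructor tracks
    field
      betweenˡ : L.Between (proj₁ s) (proj₁ p) (proj₁ r)
      betweenʳ : R.Between (proj₂ s) (proj₂ p) (proj₂ r)
      travel   : δ s p ≡ t
      balanceˡ : L.d (proj₁ p) (proj₁ r) ≤ k + R.d (proj₂ p) (proj₂ r) ⊎ proj₂ p ≡ proj₂ s
      balanceʳ : R.d (proj₂ p) (proj₂ r) ≤ k + L.d (proj₁ p) (proj₁ r) ⊎ proj₁ p ≡ proj₁ s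

  private variable
    k t : ℕ
    s p q r r′ : Vertex

  tracks-start : ∀ s r → Tracks k 0 s s r
  tracks-start s r = tracks (L.between-start _ _) (R.between-start _ _)
                            (δ-self s) (inj₂ refl) (inj₂ refl)

  -- Since all cops have made `t` moves, their distances to the robber differ exactly as those of
  -- their starts do.
  tracks-δ : Tracks k t s p r → δ s r ≡ t + δ p r
  tracks-δ {t = t} {s = z , e} {u , v} {x , y} (tracks b b′ tr _ _) =
    trans (cong₂ _+_ b b′) (trans (interchange (L.d z u) (L.d u x) (R.d e v) (R.d v y))
                                    (cong (_+ δ (u , v) (x , y)) tr))

  -- A step in the tree with the larger distance lowers the excess there from 2 to 1 and leaves the
  -- other distance at most 1 larger. A clause saying that the cop never moved in the other tree
  -- stays valid.
  tracks-chase : Tracks 2 t s p r → 0 < δ p r → Chase p r q → Tracks 1 (suc t) s q r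
  tracks-chase tr 0<δ here = contradiction (sym (δ-self _)) (<⇒≢ 0<δ)
  tracks-chase {s = z , e} (tracks b b′ tr balˡ balʳ) _ (left {u} {v} {x} {y} {w} le a c) =
    let (zwx , zw) = L.between-toward b a c in
    tracks zwx b′ (trans (cong (_+ R.d e v) zw) (cong suc tr))
           (Sum.map₁ (λ le → s≤s⁻¹ (≤-trans (≤-reflexive (sym c)) le)) balˡ)
           (inj₁ (≤-trans le (≤-reflexive c)))
  tracks-chase {s = z , e} (tracks b b′ tr balˡ balʳ) _ (right {u} {v} {x} {y} {w} le a c) =
    let (ewy , ew) = R.between-toward b′ a c in
    tracks b ewy (trans (cong (L.d z u +_) ew) (trans (+-suc (L.d z u) (R.d e v)) (cong suc tr)))
           (inj₁ (≤-trans le (≤-reflexive c)))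
           (Sum.map₁ (λ le → s≤s⁻¹ (≤-trans (≤-reflexive (sym c)) le)) balʳ)

  -- The moves by which the robber can get past a cop that started at s.
  data Slip (s : Vertex) : Vertex → Vertex → Set where
    slipˡ : ∀ {x x′ y} → x |L|.~ x′ → x ≢ proj₁ s →
            L.d (proj₁ s) x ≡ suc (L.d (proj₁ s) x′) → Slip s (x , y) (x′ , y)
    slipʳ : ∀ {x y y′} → R.d (proj₂ s) y ≡ suc (R.d (proj₂ s) y′) → Slip s (x , y) (x , y′)

  -- The robber changes one distance by at most 1, so the balance worsens from 1 to 2. By `follow`,
  -- she gets past only a cop that shares her vertex in that tree and has moved there; its balance
  -- then puts it at distance 1.
  tracks-move : Tracks 1 t s p r → 0 < δ p r → Move r r′ →
                Tracks 2 t s p r′ ⊎ (δ p r ≡ 1 × Slip s r r′)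
  tracks-move (tracks b b′ tr balˡ balʳ) _ (inj₁ refl) =
    inj₁ (tracks b b′ tr (Sum.map₁ m≤n⇒m≤1+n balˡ) (Sum.map₁ m≤n⇒m≤1+n balʳ))
  tracks-move {p = u , v} (tracks b b′ tr balˡ balʳ) 0<δ (inj₂ (moveˡ {u₁ = x} {x′} {y} refl a))
    with L.follow b a
  ... | inj₁ b″ = inj₁ (tracks b″ b′ tr
          (Sum.map₁ (λ le → ≤-trans (L.d-adjʳ a) (s≤s le)) balˡ)
          (Sum.map₁ (λ le → ≤-trans le (s≤s (L.d-adjʳ (|L|.~-sym a)))) balʳ))
  ... | inj₂ (refl , u≢z , back) = inj₂ (one balʳ , slipˡ a u≢z back)
    where
    one : _ → δ (u , v) (x , y) ≡ 1
    one (inj₁ le) = ≤-antisym (≤-trans (+-mono-≤ (≤-reflexive (L.d-self x)) le) (s≤s (≤-reflexive (L.d-self x)))) 0<δ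
    one (inj₂ u≡z) = contradiction u≡z u≢z
  tracks-move {p = u , v} (tracks b b′ tr balˡ balʳ) 0<δ (inj₂ (moveʳ {u₁ = x} {v₁ = y} {y′} refl a))
    with R.follow b′ a
  ... | inj₁ b″ = inj₁ (tracks b b″ tr
          (Sum.map₁ (λ le → ≤-trans le (s≤s (R.d-adjʳ (|R|.~-sym a)))) balˡ)
          (Sum.map₁ (λ le → ≤-trans (R.d-adjʳ a) (s≤s le)) balʳ))
  ... | inj₂ (refl , v≢e , back) = inj₂ (one balˡ , slipʳ back)
    where
    one : _ → δ (u , v) (x , y) ≡ 1
    one (inj₁ le) = ≤-antisym (≤-trans (+-mono-≤ le (≤-reflexive (R.d-self y))) (≤-reflexive (cong (λ k → suc k + 0) (R.d-self y)))) 0<δ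
    one (inj₂ v≡e) = contradiction v≡e v≢e

  -- In the second tree both cops start at `e`. In the first, `c` lies between `c′` and `x`, and as
  -- `x` differs from `c` it remains between `c′` and `x′`; so coming closer to `c` is coming closer
  -- to `c′`.
  slip-other : ∀ {c c′ e} → c |L|.~ c′ → Slip (c , e) r r′ → δ (c′ , e) r ≡ suc (δ (c , e) r) →
               δ (c′ , e) r ≡ suc (δ (c′ , e) r′)
  slip-other {c = c} {c′} {e} c~c′ (slipˡ {x} {x′} {y} a x≢c back) far = cong (_+ R.d e y) c′x≡
    where
    cc′ : L.d c′ x ≡ suc (L.d c x)
    cc′ = +-cancelʳ-≡ (R.d e y) (L.d c′ x) (suc (L.d c x)) far
    c′x≡ : L.d c′ x ≡ suc (L.d c′ x′)
    c′x≡ with L.between-toward (L.between-start c′ x) (|L|.~-sym c~c′) cc′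
    ... | b , c′c with L.follow b a
    ... | inj₂ (c≡x , _) = contradiction (sym c≡x) x≢c
    ... | inj₁ b′ = trans b (trans (cong (L.d c′ c +_) back)
                      (trans (+-suc (L.d c′ c) (L.d c x′)) (cong suc (sym b′))))
  slip-other {c′ = c′} {e} _ (slipʳ {x} {y} {y′} back) _ =
    trans (cong (L.d c′ x +_) back) (+-suc (L.d c′ x) (R.d e y′))

  module _ {c c′ : |L|.Vertex} {e : |R|.Vertex} (c~c′ : c |L|.~ c′) {D : ℕ}
           (near : ∀ r → δ (c , e) r ≤ D ⊎ δ (c′ , e) r ≤ D) where

    home : Fin 2 → Vertex
    home zero    = c , e
    home (suc _) = c′ , e

    σ : Strategy
    σ = record { cops  = cops
               ; legal = λ h r j → chase-legal (proj₂ (chase (cops h j) r)) }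
      where
      cops : History → Fin 2 → Vertex
      cops []      = home
      cops (r ∷ h) = λ j → proj₁ (chase (cops h j) r)

    -- Adjacent vertices of a tree are never equally far from `x`, and either bound of `near` passes
    -- to the nearer start.
    nearest : ∀ r → ∃[ i ] δ (home (opposite i)) r ≡ suc (δ (home i) r) × δ (home i) r ≤ D
    nearest r@(x , y) with L.d-adj x c~c′ | near r
    ... | inj₁ q | b = zero , far , [ id , (λ le → <⇒≤ (≤-trans (≤-reflexive (sym far)) le)) ]′ b
      where
      far : δ (c′ , e) r ≡ suc (δ (c , e) r)
      far = cong (_+ R.d e y) (trans (L.d-sym c′ x) (trans q (cong suc (L.d-sym x c))))
    ... | inj₂ q | b = suc zero , far , [ (λ le → <⇒≤ (≤-trans (≤-reflexive (sym far)) le)) , id ]′ b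
      where
      far : δ (c , e) r ≡ suc (δ (c′ , e) r)
      far = cong (_+ R.d e y) (trans (L.d-sym c x) (trans q (cong suc (L.d-sym x c′))))

    slip-opposite : ∀ i → Slip (home i) r r′ → δ (home (opposite i)) r ≡ suc (δ (home i) r) →
                    δ (home (opposite i)) r ≡ suc (δ (home (opposite i)) r′)
    slip-opposite zero       = slip-other c~c′
    slip-opposite (suc zero) = slip-other (|L|.~-sym c~c′)

    module _ (ρ : RobberPlay) where
      open Strategy σ using (cops)
      open RobberPlay ρ using (robber; before) renaming (legal to robber-legal)

      caught : ∀ t → Occupied σ ρ t (robber t) → CapturedIn σ ρ t
      caught zero    o = o
      caught (suc t) o = inj₂ o

      Caught : Set
      Caught = ∃[ i ] i ≤ D × CapturedIn σ ρ i

      Pursued : ℕ → Set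
      Pursued t = ∀ i → Tracks 2 t (home i) (cops (before t) i) (robber t)

      -- `i` is the cop with the nearer start, hence the nearer cop now, by exactly 1. Its distance
      -- `g` satisfies `t + g ≤ D`, which leaves just enough rounds in every case.
      round : ∀ t → Pursued t → Caught ⊎ (t < D × Pursued (suc t))
      round t tr with nearest (robber t)
      ... | i , far , le = close _ refl
        where
        j = opposite i
        a b a′ b′ x x′ : Vertex
        a  = cops (before t) i
        b  = cops (before t) j
        a′ = cops (before (suc t)) i
        b′ = cops (before (suc t)) j
        x  = robber t
        x′ = robber (suc t)

        total : ∀ {g} → δ a x ≡ g → t + g ≤ D
        total e = ≤-trans (≤-reflexive (trans (cong (t +_) (sym e)) (sym (tracks-δ (tr i))))) le

        gap-b : δ b x ≡ suc (δ a x)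
        gap-b = +-cancelˡ-≡ t (δ b x) (suc (δ a x)) (trans (sym (tracks-δ (tr j)))
                  (trans far (trans (cong suc (tracks-δ (tr i))) (sym (+-suc t (δ a x))))))

        approach : ∀ {g} → δ a x ≡ suc g →
                   (δ a′ x ≡ g × Tracks 1 (suc t) (home i) a′ x) ×
                   (δ b′ x ≡ suc g × Tracks 1 (suc t) (home j) b′ x)
        approach ga =
          (suc-injective (trans (sym (chase-closer (proj₂ (chase a x)) 0<a)) ga) ,
           tracks-chase (tr i) 0<a (proj₂ (chase a x))) ,
          (suc-injective (trans (sym (chase-closer (proj₂ (chase b x)) 0<b)) (trans gap-b (cong suc ga))) ,
           tracks-chase (tr j) 0<b (proj₂ (chase b x)))
          where
          0<a : 0 < δ a x
          0<a = subst (0 <_) (sym ga) (s≤s z≤n)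
          0<b : 0 < δ b x
          0<b = subst (0 <_) (sym gap-b) (s≤s z≤n)

        close : ∀ g → δ a x ≡ g → Caught ⊎ (t < D × Pursued (suc t))
        close zero       ga = inj₁ (t , ≤-trans (m≤m+n t 0) (total ga) , caught t (i , δ≡0⇒≡ ga))
        close (suc zero) ga = let ((ga′ , _) , _) = approach ga in
          inj₁ (suc t , ≤-trans (≤-reflexive (+-comm 1 t)) (total ga) , inj₁ (i , δ≡0⇒≡ ga′))
        close (suc (suc g)) ga with approach ga
        ... | (ga′ , tra) , (gb′ , trb)
          with tracks-move tra (subst (0 <_) (sym ga′) (s≤s z≤n)) (robber-legal t)
             | tracks-move trb (subst (0 <_) (sym gb′) (s≤s z≤n)) (robber-legal t)
        -- The farther cop is still at distance at least 2, so nobody slips past it.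
        ... | _        | inj₂ (b′≡1 , _) = contradiction (trans (sym gb′) b′≡1) λ ()
        ... | inj₁ tra′ | inj₁ trb′ =
          inj₂ (≤-trans (≤-trans (s≤s (m≤m+n t (suc g))) (≤-reflexive (sym (+-suc t (suc g))))) (total ga) ,
                both i tra′ trb′)
        -- Here `δ a x` was 2. The slip also brings the robber from distance 2 to distance 1 of the
        -- other cop, which captures in round `t + 2`.
        ... | inj₂ (a′≡1 , slip) | inj₁ trb′ with suc-injective (trans (sym ga′) a′≡1)
        ...   | refl =
          inj₁ (suc (suc t) , ≤-trans (≤-reflexive (+-comm 2 t)) (total ga) , inj₁ (j , δ≡0⇒≡ gb″))
            where
            gb′x′ : δ b′ x′ ≡ 1
            gb′x′ = +-cancelˡ-≡ (suc t) (δ b′ x′) 1 (suc-injective (begin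
              suc (suc t + δ b′ x′)   ≡⟨ cong suc (tracks-δ trb′) ⟨
              suc (δ (home j) x′)     ≡⟨ slip-opposite i slip far ⟨
              δ (home j) x            ≡⟨ far ⟩
              suc (δ (home i) x)      ≡⟨ cong suc (tracks-δ (tr i)) ⟩
              suc (t + δ a x)         ≡⟨ cong (λ k → suc (t + k)) ga ⟩
              suc (t + 2)             ≡⟨ cong suc (+-suc t 1) ⟩
              suc (suc t + 1)         ∎))
              where open ≡-Reasoning
            gb″ : δ (cops (before (suc (suc t))) j) x′ ≡ 0
            gb″ = suc-injective
              (trans (sym (chase-closer (proj₂ (chase b′ x′)) (subst (0 <_) (sym gb′x′) (s≤s z≤n)))) gb′x′)

      -- `n` bounds the rounds left and makes the recursion structural.
      pursue : ∀ n t → D ≤ t + n → Pursued t → Caught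
      pursue n t D≤t+n tr with round t tr
      pursue n       t D≤t+n tr | inj₁ win         = win
      pursue zero    t D≤t+n tr | inj₂ (t<D , _)   =
        contradiction (≤-trans D≤t+n (≤-reflexive (+-identityʳ t))) (<⇒≱ t<D)
      pursue (suc n) t D≤t+n tr | inj₂ (_ , tr′)   =
        pursue n (suc t) (≤-trans D≤t+n (≤-reflexive (+-suc t n))) tr′

    cops-win : CopsWinWithin D
    cops-win = σ , λ ρ → pursue ρ D 0 ≤-refl λ i → tracks-start (home i) _

-- Exchanging the factors, and the upper bound

swap-move : ∀ {k G H p q} → Game.Move k (G □ H) p q → Game.Move k (H □ G) (swap p) (swap q)
swap-move (inj₁ refl)        = inj₁ refl
swap-move (inj₂ (moveʳ e a)) = inj₂ (moveˡ e a)
swap-move (inj₂ (moveˡ e a)) = inj₂ (moveʳ e a)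

module _ (k : ℕ) (G H : Graph) where
  private
    module G□H = Game k (G □ H)
    module H□G = Game k (H □ G)

  CopsWinWithin-swap : ∀ {t} → H□G.CopsWinWithin t → G□H.CopsWinWithin t
  CopsWinWithin-swap (σ , win) = σ′ , λ ρ → let (i , i≤t , c) = win (ρ′ ρ) in i , i≤t , captured ρ i c
    where
    module σ = H□G.Strategy σ
    σ′ : G□H.Strategy
    σ′ = record { cops  = λ h j → swap (σ.cops (map swap h) j)
                ; legal = λ h r j → swap-move {k} {H} {G} (σ.legal (map swap h) (swap r) j) }
    ρ′ : G□H.RobberPlay → H□G.RobberPlay
    ρ′ ρ = record { robber = swap ∘ robber ; legal = swap-move {k} {G} {H} ∘ legal }
      where open G□H.RobberPlay ρ
    occupied : ∀ ρ i v → H□G.Occupied σ (ρ′ ρ) i (swap v) → G□H.Occupied σ′ ρ i v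
    occupied ρ i v (j , e) = j , cong swap (trans (cong (λ h → σ.cops h j) (sym (before-swap i))) e)
      where
      before-swap : ∀ i → H□G.RobberPlay.before (ρ′ ρ) i ≡ map swap (G□H.RobberPlay.before ρ i)
      before-swap zero    = refl
      before-swap (suc i) = cong (_ ∷_) (before-swap i)
    captured : ∀ ρ i → H□G.CapturedIn σ (ρ′ ρ) i → G□H.CapturedIn σ′ ρ i
    captured ρ zero    o = occupied ρ 0 _ o
    captured ρ (suc i) o = Sum.map (occupied ρ (suc i) _) (occupied ρ (suc i) _) o

CopsWinWithin-mono : ∀ {k G s t} → s ≤ t → Game.CopsWinWithin k G s → Game.CopsWinWithin k G t
CopsWinWithin-mono s≤t (σ , win) = σ , λ ρ → let (i , i≤s , c) = win ρ in i , ≤-trans i≤s s≤t , c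

-- The first inequality fails only for even `a` and odd `b`, and then the second holds.
halves : ∀ a b → ⌊ a /2⌋ + ⌈ b /2⌉ ≤ ⌊ a + b /2⌋ ⊎ ⌊ b /2⌋ + ⌈ a /2⌉ ≤ ⌊ a + b /2⌋
halves zero    zero    = inj₁ z≤n
halves zero    (suc zero) = inj₂ z≤n
halves zero    (suc (suc b)) with halves zero b
... | inj₁ le = inj₁ (s≤s le)
... | inj₂ le = inj₂ (s≤s le)
halves (suc zero) zero = inj₁ z≤n
halves (suc zero) (suc zero) = inj₁ (s≤s z≤n)
halves (suc zero) (suc (suc b)) with halves (suc zero) b
... | inj₁ le = inj₁ (s≤s le)
... | inj₂ le = inj₂ (s≤s le)
halves (suc (suc a)) b with halves a b
... | inj₁ le = inj₁ (s≤s le)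
... | inj₂ le = inj₂ (≤-trans (≤-reflexive (+-suc ⌊ b /2⌋ ⌈ a /2⌉)) (s≤s le))

module _ (T₁ T₂ : Graph) (acyclic₁ : IsTree T₁) (acyclic₂ : IsTree T₂)
         (0<a : 0 < diam T₁) (0<b : 0 < diam T₂) where

  cops-win-halves : Game.CopsWinWithin 2 (T₁ □ T₂) (⌊ diam T₁ /2⌋ + ⌈ diam T₂ /2⌉)
  cops-win-halves =
    let (_ , _ , ex) = L.diam-attained 0<a
        (_ , _ , ey) = R.diam-attained 0<b
        (c , c′ , c~c′ , _ , near) = L.center-edge L.d≤diam 0<a ex
        (e , _ , _ , ecc , _) = R.center-edge R.d≤diam 0<b ey
    in Pursuit.cops-win T₁ T₂ acyclic₁ acyclic₂ {e = e} c~c′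
         λ (x , y) → Sum.map (λ le → +-mono-≤ le (ecc y)) (λ le → +-mono-≤ le (ecc y)) (near x)
    where
    module L = Tree T₁ acyclic₁
    module R = Tree T₂ acyclic₂

upper-bound : (T₁ T₂ : Graph) → IsTree T₁ → IsTree T₂ → 0 < diam T₁ → 0 < diam T₂ →
              Game.CopsWinWithin 2 (T₁ □ T₂) ⌊ diam T₁ + diam T₂ /2⌋
upper-bound T₁ T₂ acyclic₁ acyclic₂ 0<a 0<b with halves (diam T₁) (diam T₂)
... | inj₁ le = CopsWinWithin-mono le (cops-win-halves T₁ T₂ acyclic₁ acyclic₂ 0<a 0<b)
... | inj₂ le = CopsWinWithin-mono le (CopsWinWithin-swap 2 T₁ T₂
                  (cops-win-halves T₂ T₁ acyclic₂ acyclic₁ 0<b 0<a))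

-- The robber's strategy

IsLeaf : (G : Graph) → Graph.Vertex G → Graph.Vertex G → Set
IsLeaf G x x′ = x ~ x′ × (∀ {w} → x ~ w → w ≡ x′)
  where open Graph G

module Flip (G : Graph) {x x′ : Graph.Vertex G} (leaf : IsLeaf G x x′) where
  open Graph G
  open Distance G

  private
    x~x′ = proj₁ leaf

  abstract
    -- The nearest end of the leaf edge is `x` for `x` itself and `x′` for all other vertices;
    -- `flip` takes the opposite end.
    flip : Vertex → Vertex
    flip u with u ≟ x
    ... | yes _ = x′
    ... | no  _ = x

    flip-≢ : ∀ u → u ≢ flip u
    flip-≢ u with u ≟ x
    ... | yes refl = λ e → ~-irrefl (subst (u ~_) (sym e) x~x′)
    ... | no  u≢x  = u≢x

    flip-adj : ∀ {u w} → u ~ w → flip u ≡ flip w ⊎ flip u ~ flip w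
    flip-adj {u} {w} a with u ≟ x | w ≟ x
    ... | yes refl | yes refl = inj₁ refl
    ... | yes refl | no _     = inj₂ (~-sym x~x′)
    ... | no _     | yes refl = inj₂ x~x′
    ... | no _     | no _     = inj₁ refl

    flip-d : ∀ u → d (flip u) x ≤ 1
    flip-d u with u ≟ x
    ... | yes _ = ≤-trans (d-adjˡ (~-sym x~x′)) (s≤s (≤-reflexive (d-self x)))
    ... | no  _ = ≤-trans (≤-reflexive (d-self x)) z≤n

    flip-d≡0 : ∀ {u} → u ≢ x → d (flip u) x ≡ 0
    flip-d≡0 {u} u≢x with u ≟ x
    ... | yes u≡x = contradiction u≡x u≢x
    ... | no  _   = d-self x

module Evasion (G H : Graph) (σ : Game.Strategy 2 (G □ H)) where
  private
    module |G| = Graph G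
  open Graph (G □ H) using (Vertex)
  open Game 2 (G □ H)
  open Product G H using (δ; δ-self; δ-adj; δ≡0⇒≡)
  open Strategy σ using (cops) renaming (legal to cops-legal)

  δ-move : ∀ {p q} r → Move p q → δ p r ≤ suc (δ q r)
  δ-move r (inj₁ refl) = n≤1+n _
  δ-move r (inj₂ a)    = δ-adj r a

  cops-approach : ∀ ρ i j r → δ (cops [] j) r ≤ i + δ (cops (RobberPlay.before ρ i) j) r
  cops-approach ρ zero    j r = ≤-refl
  cops-approach ρ (suc i) j r = ≤-trans (cops-approach ρ i j r)
    (≤-trans (+-monoʳ-≤ i (δ-move r (cops-legal _ _ j))) (≤-reflexive (+-suc i _)))

  Survives : ℕ → Set
  Survives s = ∃[ ρ ] ∀ i → i ≤ s → ¬ CapturedIn σ ρ i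

  stand-still : ∀ {s} r → (∀ j → s < δ (cops [] j) r) → Survives s
  stand-still {s} r far = ρ , uncaptured
    where
    ρ : RobberPlay
    ρ = record { robber = λ _ → r ; legal = λ _ → inj₁ refl }
    unoccupied : ∀ i → i ≤ s → ¬ Occupied σ ρ i r
    unoccupied i i≤s (j , e) = <⇒≱ (far j) (≤-trans (cops-approach ρ i j r)
      (≤-trans (≤-reflexive (trans (cong (λ p → i + δ p r) e) (trans (cong (i +_) (δ-self r)) (+-identityʳ i)))) i≤s))
    uncaptured : ∀ i → i ≤ s → ¬ CapturedIn σ ρ i
    uncaptured zero    i≤s o        = unoccupied 0 i≤s o
    uncaptured (suc i) i≤s (inj₁ o) = unoccupied (suc i) i≤s o
    uncaptured (suc i) i≤s (inj₂ o) = unoccupied (suc i) i≤s o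

  module _ {x x′ y y′} (leafˡ : IsLeaf G x x′) (leafʳ : IsLeaf H y y′) where
    private
      module L = Flip G leafˡ
      module R = Flip H leafʳ

    corner : Vertex
    corner = x , y

    -- The unit square at the corner is x, x′ times y, y′; the robber stays
    -- diagonally opposite to the projection of one cop onto it.
    dodge : Vertex → Vertex
    dodge (u , v) = L.flip u , R.flip v

    -- `flip` sends an edge to an edge or a single vertex, so the robber can mirror every move of
    -- the cop.
    dodge-move : ∀ {p q} → Move p q → Move (dodge p) (dodge q)
    dodge-move (inj₁ refl) = inj₁ refl
    dodge-move (inj₂ (moveʳ refl a)) = Sum.map (cong (_ ,_)) (moveʳ refl) (R.flip-adj a)
    dodge-move (inj₂ (moveˡ refl a)) = Sum.map (cong (_, _)) (moveˡ refl) (L.flip-adj a)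

    -- A cop's move keeps one of its coordinates, whereas `dodge p` differs from `p` in both.
    dodge-missed : ∀ {p q} → Move p q → q ≢ dodge p
    dodge-missed (inj₁ refl)           e = L.flip-≢ _ (cong proj₁ e)
    dodge-missed (inj₂ (moveʳ refl a)) e = L.flip-≢ _ (cong proj₁ e)
    dodge-missed (inj₂ (moveˡ refl a)) e = R.flip-≢ _ (cong proj₂ e)

    dodge-δ : ∀ p → δ (dodge p) corner ≤ 2
    dodge-δ (u , v) = +-mono-≤ (L.flip-d u) (R.flip-d v)

    -- The robber is at `(x′ , y′)`, the vertex of the square at distance 2 from the corner, only
    -- while the dodged cop is on the corner.
    dodge-δ≤1 : ∀ p → p ≢ corner → δ (dodge p) corner ≤ 1
    dodge-δ≤1 (u , v) p≢ with u |G|.≟ x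
    ... | no  u≢x  = subst (λ k → k + _ ≤ 1) (sym (L.flip-d≡0 u≢x)) (R.flip-d v)
    ... | yes refl = subst (λ k → _ + k ≤ 1) (sym (R.flip-d≡0 (p≢ ∘ cong (u ,_))))
                       (≤-trans (≤-reflexive (+-identityʳ _)) (L.flip-d u))

    -- Cop `n` is dodged; the other one is too late because the square lies within 2 of the corner.
    -- The bound 3 protects round 0. The last hypothesis protects the cops' move in round `s`:
    -- either the far cop is one step farther still, or cop `n` is not on the corner before round
    -- `s`, which keeps the robber within 1 of it.
    dodge-near : ∀ {s} n → 2 + s ≤ δ (cops [] (opposite n)) corner → 3 ≤ δ (cops [] (opposite n)) corner →
                 s ≤ δ (cops [] n) corner ⊎ 3 + s ≤ δ (cops [] (opposite n)) corner → Survives s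
    dodge-near {s} n far far₃ apart = ρ , uncaptured
      where
      -- From round s on the robber rests: dodging the near cop in round s might
      -- take her onto the far one.
      response : ℕ → History → Vertex
      response (suc i) (r ∷ h) with suc i <? s
      ... | yes _ = dodge (cops (r ∷ h) n)
      ... | no  _ = r
      -- This is round 0; an empty history in a later round does not arise.
      response _ h = dodge (cops h n)

      history : ℕ → History
      history zero    = []
      history (suc i) = response i (history i) ∷ history i

      dodges : ∀ i → i < s → response i (history i) ≡ dodge (cops (history i) n)
      dodges zero    _ = refl
      dodges (suc i) lt with suc i <? s
      ... | yes _ = refl
      ... | no ¬lt = contradiction lt ¬lt

      legal : ∀ i → Move (response i (history i)) (response (suc i) (history (suc i)))
      legal i with suc i <? s
      ... | yes lt = subst (λ r → Move r (dodge (cops (history (suc i)) n))) (sym (dodges i (<⇒≤ lt)))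
                           (dodge-move (cops-legal _ _ n))
      ... | no _   = inj₁ refl

      ρ : RobberPlay
      ρ = record { robber = λ i → response i (history i) ; legal = legal }
      open RobberPlay ρ using (robber; before)

      before≡history : ∀ i → before i ≡ history i
      before≡history zero    = refl
      before≡history (suc i) = cong (response i (history i) ∷_) (before≡history i)

      robber-dodges : ∀ {i} → i < s → robber i ≡ dodge (cops (before i) n)
      robber-dodges {i} lt = trans (dodges i lt) (cong (λ h → dodge (cops h n)) (sym (before≡history i)))

      reach : ∀ {i k m} r → cops (before i) (opposite n) ≡ r → δ r corner ≤ m →
              k ≤ δ (cops [] (opposite n)) corner → k ≤ m + i
      reach {i} {m = m} r refl le k≤ = ≤-trans k≤
        (≤-trans (cops-approach ρ i (opposite n) corner)
          (≤-trans (+-monoʳ-≤ i le) (≤-reflexive (+-comm i m))))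

      off-corner : ∀ {i} → i < s → s ≤ δ (cops [] n) corner → cops (before i) n ≢ corner
      off-corner {i} i<s s≤ e = <⇒≱ i<s (≤-trans s≤ (≤-trans (cops-approach ρ i n corner)
        (≤-reflexive (trans (cong (λ p → i + δ p corner) e) (trans (cong (i +_) (δ-self corner)) (+-identityʳ i))))))

      free-after-move : ∀ i → i ≡ 0 ⊎ i < s → ¬ Occupied σ ρ i (dodge (cops (before i) n))
      free-after-move i early (j , e) = both {λ j → cops (before i) j ≢ dodge (cops (before i) n)} n
        (dodge-missed (inj₁ refl)) (λ e → far-away e early) j e
        where
        far-away : cops (before i) (opposite n) ≡ dodge (cops (before i) n) → ¬ (i ≡ 0 ⊎ i < s)
        far-away e (inj₁ refl) = <⇒≱ (reach {0} _ e (dodge-δ _) far₃) ≤-refl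
        far-away e (inj₂ i<s)  = <⇒≱ i<s (s≤s⁻¹ (s≤s⁻¹ (reach {i} _ e (dodge-δ _) far)))

      free-after-cops : ∀ i → i < s → ¬ Occupied σ ρ (suc i) (dodge (cops (before i) n))
      free-after-cops i i<s (j , e) = both {λ j → cops (before (suc i)) j ≢ dodge (cops (before i) n)} n
        (dodge-missed (cops-legal _ _ n)) (λ e → far-away e apart) j e
        where
        far-away : cops (before (suc i)) (opposite n) ≡ dodge (cops (before i) n) →
                   ¬ (s ≤ δ (cops [] n) corner ⊎ 3 + s ≤ δ (cops [] (opposite n)) corner)
        far-away e (inj₁ s≤) = <⇒≱ i<s (s≤s⁻¹ (s≤s⁻¹
          (reach {suc i} _ e (dodge-δ≤1 _ (off-corner i<s s≤)) far)))
        far-away e (inj₂ farther) = <⇒≱ i<s (s≤s⁻¹ (s≤s⁻¹ (s≤s⁻¹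
          (reach {suc i} _ e (dodge-δ _) farther))))

      uncaptured : ∀ i → i ≤ s → ¬ CapturedIn σ ρ i
      uncaptured zero    _   o        = free-after-move 0 (inj₁ refl) o
      uncaptured (suc i) i<s (inj₁ o) = free-after-cops i i<s (subst (Occupied σ ρ (suc i)) (robber-dodges i<s) o)
      uncaptured (suc i) i<s (inj₂ o) with suc i <? s
      ... | yes lt = free-after-move (suc i) (inj₂ lt)
                       (subst (Occupied σ ρ (suc i)) (cong (λ h → dodge (cops h n)) (sym (before≡history (suc i)))) o)
      -- In round `s` the robber rests, so her vertex was already checked after the cops' move.
      ... | no _   = free-after-cops i i<s (subst (Occupied σ ρ (suc i)) (robber-dodges i<s) o)

-- The lower bound

module _ (T₁ T₂ : Graph) (acyclic₁ : IsTree T₁) (acyclic₂ : IsTree T₂)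
         (0<a : 0 < diam T₁) (0<b : 0 < diam T₂) (σ : Game.Strategy 2 (T₁ □ T₂)) where
  private
    module L = Tree T₁ acyclic₁
    module R = Tree T₂ acyclic₂
  open Product T₁ T₂ using (δ; δ≡0⇒≡)
  open Evasion T₁ T₂ σ
  open Game.Strategy σ using (cops)

  survives : ∀ s → suc s + suc s ≤ diam T₁ + diam T₂ → Survives s
  survives s 2s+2≤ with L.diam-attained 0<a | R.diam-attained 0<b
  ... | x , x′ , xx′ | y , y′ , yy′ = choose
    where
    K K′ : _
    K  = x , y
    K′ = x′ , y′

    leafˡ : ∀ {u v} → L.d u v ≡ diam T₁ → ∃ (IsLeaf T₁ v)
    leafˡ uv = L.diametral-leaf (λ p q → ≤-trans (L.d≤diam p q) (≤-reflexive (sym uv))) (subst (0 <_) (sym uv) 0<a)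
    leafʳ : ∀ {u v} → R.d u v ≡ diam T₂ → ∃ (IsLeaf T₂ v)
    leafʳ uv = R.diametral-leaf (λ p q → ≤-trans (R.d≤diam p q) (≤-reflexive (sym uv))) (subst (0 <_) (sym uv) 0<b)

    corners-apart : ∀ p → suc s + suc s ≤ δ p K + δ p K′
    corners-apart (u , v) = ≤-trans 2s+2≤ (≤-trans
      (+-mono-≤ (via L.d-triangle L.d-sym xx′) (via R.d-triangle R.d-sym yy′))
      (≤-reflexive (interchange (L.d u x) (L.d u x′) (R.d v y) (R.d v y′))))
      where
      via : ∀ {A : Set} {d : A → A → ℕ} {u x x′ n} → (∀ u v w → d u w ≤ d u v + d v w) →
            (∀ u v → d u v ≡ d v u) →
            d x x′ ≡ n → n ≤ d u x + d u x′
      via {d = d} {u} {x} {x′} tri dsym e = ≤-trans (≤-reflexive (sym e))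
        (≤-trans (tri x u x′) (≤-reflexive (cong (_+ d u x′) (dsym x u))))

    -- `i` is slack: each step by which a cop is nearer than `s` to one corner adds to its distance
    -- from the other.
    opposite-far : ∀ {m k} i → k + i ≤ s → suc s + suc s ≤ m + k → 2 + s + i ≤ m
    opposite-far {m} {k} i k+i≤s le = +-cancelʳ-≤ k (2 + s + i) m
      (≤-trans (≤-trans (≤-reflexive (shift s i k)) (s≤s (+-monoʳ-≤ s (s≤s k+i≤s)))) le)
      where
      shift : ∀ s i k → 2 + s + i + k ≡ suc (s + suc (k + i))
      shift = solve-∀

    -- A cop within s of one corner is at distance at least 2 + s from the
    -- opposite corner.  The robber's square is at K′ if cop n is strictly within
    -- s of K, as the other cop's distance to K may then be too small, and at K
    -- otherwise.
    corners-covered : ∀ n → δ (cops [] n) K ≤ s → δ (cops [] (opposite n)) K′ ≤ s → Survives s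
    corners-covered n nK≤s fK′≤s with m≤n⇒m<n∨m≡n nK≤s
    ... | inj₁ nK<s = dodge-near (proj₂ (leafˡ xx′)) (proj₂ (leafʳ yy′)) (opposite n)
            (≤-trans (n≤1+n _) n-far) (≤-trans (s≤s (s≤s (s≤s z≤n))) n-far) (inj₂ n-far)
      where
      n-far : 3 + s ≤ δ (cops [] (opposite (opposite n))) K′
      n-far = subst (λ j → 3 + s ≤ δ (cops [] j) K′) (sym (opposite-involutive n))
        (≤-trans (≤-reflexive (cong (2 +_) (+-comm 1 s)))
          (opposite-far 1 (≤-trans (≤-reflexive (+-comm _ 1)) nK<s)
            (≤-trans (corners-apart (cops [] n)) (≤-reflexive (+-comm (δ (cops [] n) K) _)))))
    ... | inj₂ nK≡s with 0 <? s
    ...   | yes 0<s = dodge-near (proj₂ (leafˡ (trans (L.d-sym x′ x) xx′)))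
            (proj₂ (leafʳ (trans (R.d-sym y′ y) yy′))) n
            f-far (≤-trans (s≤s (s≤s 0<s)) f-far) (inj₁ (≤-reflexive (sym nK≡s)))
      where
      f-far : 2 + s ≤ δ (cops [] (opposite n)) K
      f-far = ≤-trans (≤-reflexive (sym (+-identityʳ (2 + s))))
        (opposite-far 0 (≤-trans (≤-reflexive (+-identityʳ _)) fK′≤s) (corners-apart (cops [] (opposite n))))
    -- For `s` = 0 the cops stand on `K` and `K′`, where distance 3 is not guaranteed; the mixed
    -- corner differs from both.
    ...   | no s≯0 = stand-still (x , y′) (both n (≤-trans (s≤s s≤0) n-far) (≤-trans (s≤s s≤0) f-far))
      where
      s≤0 : s ≤ 0
      s≤0 = ≮⇒≥ s≯0
      n-far : 0 < δ (cops [] n) (x , y′)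
      n-far = subst (λ p → 0 < δ p (x , y′)) (sym (δ≡0⇒≡ (n≤0⇒n≡0 (≤-trans nK≤s s≤0))))
        (≤-trans 0<b (≤-trans (≤-reflexive (sym yy′)) (m≤n+m _ _)))
      f-far : 0 < δ (cops [] (opposite n)) (x , y′)
      f-far = subst (λ p → 0 < δ p (x , y′)) (sym (δ≡0⇒≡ (n≤0⇒n≡0 (≤-trans fK′≤s s≤0))))
        (≤-trans 0<a (≤-trans (≤-reflexive (trans (sym xx′) (L.d-sym x x′))) (m≤m+n _ _)))

    -- Cop `n` is too far from `K′`, so only the other cop can make standing at `K′` unsafe.
    close-to-K : ∀ n → δ (cops [] n) K ≤ s → Survives s
    close-to-K n nK≤s with s <? δ (cops [] (opposite n)) K′
    ... | no ¬f-far = corners-covered n nK≤s (≮⇒≥ ¬f-far)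
    ... | yes f-far = stand-still K′ (both n n-far f-far)
      where
      n-far : s < δ (cops [] n) K′
      n-far = ≤-trans (≤-trans (n≤1+n _) (m≤m+n (2 + s) 0))
        (opposite-far 0 (≤-trans (≤-reflexive (+-identityʳ _)) nK≤s)
          (≤-trans (corners-apart (cops [] n)) (≤-reflexive (+-comm (δ (cops [] n) K) _))))

    choose : Survives s
    choose with s <? δ (cops [] zero) K | s <? δ (cops [] (suc zero)) K
    ... | yes p | yes q = stand-still K (both zero p q)
    ... | no ¬p | _     = close-to-K zero (≮⇒≥ ¬p)
    ... | yes _ | no ¬q = close-to-K (suc zero) (≮⇒≥ ¬q)

lower-bound : (T₁ T₂ : Graph) → IsTree T₁ → IsTree T₂ → 0 < diam T₁ → 0 < diam T₂ →
              ∀ s → Game.CopsWinWithin 2 (T₁ □ T₂) s → ⌊ diam T₁ + diam T₂ /2⌋ ≤ s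
lower-bound T₁ T₂ acyclic₁ acyclic₂ 0<a 0<b s (σ , win) = ≮⇒≥ λ s<N →
  let n = diam T₁ + diam T₂
      (ρ , uncaptured) = survives T₁ T₂ acyclic₁ acyclic₂ 0<a 0<b σ s
        -- `suc s` is at most the lower half of `n`, hence also at most the upper half.
        (≤-trans (+-mono-≤ s<N (≤-trans s<N (⌊n/2⌋≤⌈n/2⌉ n))) (≤-reflexive (⌊n/2⌋+⌈n/2⌉≡n n)))
      (i , i≤s , captured) = win ρ
  in uncaptured i i≤s captured

theorem2 : (T₁ T₂ : Graph) → IsTree T₁ → IsTree T₂ →
    0 < diam T₁ → 0 < diam T₂ →
    IsCaptureTime 2 (T₁ □ T₂) ⌊ diam (T₁ □ T₂) /2⌋
theorem2 T₁ T₂ acyclic₁ acyclic₂ 0<a 0<b =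
  subst (λ n → IsCaptureTime 2 (T₁ □ T₂) ⌊ n /2⌋) (sym (Product.diam-□ T₁ T₂ 0<a 0<b))
    (upper-bound T₁ T₂ acyclic₁ acyclic₂ 0<a 0<b , lower-bound T₁ T₂ acyclic₁ acyclic₂ 0<a 0<b)
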